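{- For natural numbers $a,b,c,d,m,n,S$ such that $n \geq a \geq b$, $m \geq c \geq d$, and $\max(mb, nd)\leq S\leq \min(ma, nc)$, the following conditions are equivalent. (a) All pairs $(\underline{e},\underline{f}) \in P(a,b,c,d,m,n,S)$ are bipartite graphic. (b) $a=b$ or $c=d$ or, when $a>b$ and $c>d$, $$ar+cs \leq S + rs + \min\{\,r-p-d,\; s-q-b,\; r+s-p-q-b-d+1,\; 0\,\},$$ where $r=\left\lfloor\frac{S-mb}{a-b}\right\rfloor$, $s=\left\lfloor\frac{S-nd}{c-d}\right\rfloor$, $p=S-cs-d(n-s)$ and $q=S-ar-b(m-r)$.
   Context: For natural numbers $a,b,c,d,m,n,S$, $P(a,b,c,d,m,n,S)$ denotes the set of pairs $(\underline{e},\underline{f})$ of integer sequences of length $m,n$ respectively, each having sum $S$, with $\max(\underline{e})=a$, $\min(\underline{e})=b$, $\max(\underline{f})=c$, $\min(\underline{f})=d$ (maximum and minimum entries of the sequences). A pair $(\underline{e},\underline{f})$ of integer sequences is bipartite graphic if there exists a (simple) bipartite graph whose degree sequences are $\underline{e}$ and $\underline{f}$, that is, $\underline{e}$ lists the degrees of the vertices in one part and $\underline{f}$ lists the degrees of the vertices in the other part.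
   Formalization: The set P(a,b,c,d,m,n,S) is additionally assumed non-empty; without this the equivalence fails, e.g. for (a,b,c,d,m,n,S)=(3,0,2,0,2,3,2), where P is empty, so (a) holds vacuously, but the inequality in (b) reads 2≤1. -}

module Defs where

open import Data.Bool using (Bool)
open import Data.Fin using (Fin)
open import Data.Fin.Subset using (Subset; ∣_∣)
open import Data.Integer using (ℤ; +_; _+_; _-_; _*_; _≤_; _⊓_)
import Data.Integer.Properties as ℤₚ
import Data.Nat as ℕ
open import Data.Nat using (ℕ; NonZero; >-nonZero)
open import Data.Nat.DivMod using (_/_)
open import Data.Nat.Properties using (m<n⇒0<n∸m)
open import Data.Product using (∃; ∃₂; ∃-syntax; _×_; _,_)
open import Data.Sum using (_⊎_)
open import Data.Vec using (tabulate)
open import Data.Vec.Functional using (Vector)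
open import Level using (0ℓ)
open import Relation.Binary.PropositionalEquality using (_≡_)
open import Relation.Unary using (Pred)

open import Algebra.Properties.Monoid.Sum ℤₚ.+-0-monoid using (sum)

IsMaximum : ∀ {n} → Vector ℤ n → ℤ → Set
IsMaximum v x = (∃[ i ] v i ≡ x) × (∀ i → v i ≤ x)

IsMinimum : ∀ {n} → Vector ℤ n → ℤ → Set
IsMinimum v x = (∃[ i ] v i ≡ x) × (∀ i → x ≤ v i)

P : (a b c d m n S : ℕ) → Pred (Vector ℤ m × Vector ℤ n) 0ℓ
P a b c d m n S (e , f) =
  (sum e ≡ + S × IsMaximum e (+ a) × IsMinimum e (+ b)) ×
  (sum f ≡ + S × IsMaximum f (+ c) × IsMinimum f (+ d))

-- A simple bipartite graph whose (labelled) parts are Fin m and Fin n.  Edges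
-- only join the two parts, and a Boolean adjacency excludes multiple edges.
record BipartiteGraph (m n : ℕ) : Set where
  field
    edge : Fin m → Fin n → Bool

  neighboursˡ : Fin m → Subset n
  neighboursˡ x = tabulate (λ y → edge x y)

  neighboursʳ : Fin n → Subset m
  neighboursʳ y = tabulate (λ x → edge x y)

  degreeˡ : Fin m → ℕ
  degreeˡ x = ∣ neighboursˡ x ∣

  degreeʳ : Fin n → ℕ
  degreeʳ y = ∣ neighboursʳ y ∣

BipartiteGraphic : ∀ {m n} → Pred (Vector ℤ m × Vector ℤ n) 0ℓ
BipartiteGraphic {m} {n} (e , f) =
  ∃ λ (G : BipartiteGraph m n) → let open BipartiteGraph G in
    (∀ x → e x ≡ + degreeˡ x) × (∀ y → f y ≡ + degreeʳ y)

-- ⌊ (S - k l) / (u - l) ⌋.  The truncated subtractions are exact because this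
-- is only used where k l ≤ S and l < u.
quot : (u l k S : ℕ) → l ℕ.< u → ℕ
quot u l k S l<u = (S ℕ.∸ k ℕ.* l) / (u ℕ.∸ l)
  where
  instance
    u∸l≢0 : NonZero (u ℕ.∸ l)
    u∸l≢0 = >-nonZero (m<n⇒0<n∸m l<u)

-- S - u t - l (k - t)
rest : (u l k S t : ℕ) → ℤ
rest u l k S t = + S - + u * + t - + l * (+ k - + t)

NumericalCondition : (a b c d m n S : ℕ) → b ℕ.< a → d ℕ.< c → Set
NumericalCondition a b c d m n S b<a d<c =
  + a * + r + + c * + s ≤
    + S + + r * + s +
      ((+ r - p - + d) ⊓
       (+ s - q - + b) ⊓
       (+ r + + s - p - q - + b - + d + + 1) ⊓
       + 0)
  where
  r s : ℕ
  r = quot a b m S b<a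
  s = quot c d n S d<c
  p q : ℤ
  p = rest c d n S s
  q = rest a b m S r

ConditionB : (a b c d m n S : ℕ) → Set
ConditionB a b c d m n S =
  a ≡ b ⊎ c ≡ d ⊎
  ∃₂ λ (b<a : b ℕ.< a) (d<c : d ℕ.< c) → NumericalCondition a b c d m n S b<a d<c

{-# OPTIONS --safe #-}

-- Among the sequences of given length, sum, maximum and minimum there is a most spread one,
-- consisting of r maxima, one intermediate entry and minima, and its partial sums dominate those
-- of all the others.  By Gale–Ryser, (e, f) is bipartite graphic iff the sum of any k entries of
-- e and any l entries of f is at most S + k l.  For the spread pair the left-hand side is
-- piecewise linear in k and in l with breaks at {r, r + 1} and {s, s + 1}; at the ends of the
-- ranges the bound is automatic, so only these four points matter, and they give the four terms
-- of the minimum.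
module Submission where

open import Defs
open import Data.Bool using (Bool; true; false; T)
open import Data.Fin using (Fin; zero; suc)
import Data.Fin.Subset as Subset
import Data.Integer as ℤ
open import Data.Integer using (ℤ; +_)
import Data.Integer.Properties as ℤₚ
import Data.Integer.Tactic.RingSolver as ℤ-Solver
open import Data.Product using (∃; ∃₂; ∃-syntax; _×_; _,_; proj₁; proj₂)
open import Data.Sum using (_⊎_; inj₁; inj₂)
open import Data.Vec using (tabulate)
open import Data.Vec.Functional using (Vector; _∷_; []; tail)
open import Function using (_∘_; const)
open import Function.Bundles using (_⇔_; mk⇔)
open import Relation.Binary.PropositionalEquality
open import Relation.Nullary using (yes; no; contradiction)
open import Relation.Unary using (Satisfiable; _⊆_)

-- Integer inequalities: from arbitrary cuts to four corner cuts.

module IntegerBounds where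

  open import Data.Integer using (_+_; _-_; _*_; _≤_; _⊓_; 0ℤ; 1ℤ; nonNegative; nonPositive)
  open import Data.Integer.Properties
  open import Data.Integer.Tactic.RingSolver using (solve-∀)

  -- Comparing slacks instead of sides turns each inequality below into a polynomial identity for
  -- the ring solver; `≤-combine` does the same with two given inequalities.
  ≤-shift : ∀ {x y p q} → q - p ≡ y - x → p ≤ q → x ≤ y
  ≤-shift eq p≤q = 0≤i-j⇒j≤i (subst (0ℤ ≤_) eq (i≤j⇒0≤j-i p≤q))

  ≤-combine : ∀ {x y p q p′ q′} → (q - p) + (q′ - p′) ≡ y - x → p ≤ q → p′ ≤ q′ → x ≤ y
  ≤-combine eq p≤q p′≤q′ = 0≤i-j⇒j≤i (subst (0ℤ ≤_) eq (+-mono-≤ (i≤j⇒0≤j-i p≤q) (i≤j⇒0≤j-i p′≤q′)))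

  *-monoˡ-0≤ : ∀ {x y z} → 0ℤ ≤ z → x ≤ y → z * x ≤ z * y
  *-monoˡ-0≤ {z = z} 0≤z = *-monoˡ-≤-nonNeg z {{nonNegative 0≤z}}

  -- A linear function on an interval is largest at one of the two ends, and the sign of `δ` tells
  -- which.
  interpolate : ∀ δ {γ lo k hi} → lo ≤ k → k ≤ hi → δ * lo ≤ γ → δ * hi ≤ γ → δ * k ≤ γ
  interpolate δ lo≤k k≤hi at-lo at-hi with ≤-total 0ℤ δ
  ... | inj₁ 0≤δ = ≤-trans (*-monoˡ-≤-nonNeg δ {{nonNegative 0≤δ}} k≤hi) at-hi
  ... | inj₂ δ≤0 = ≤-trans (*-monoˡ-≤-nonPos δ {{nonPositive δ≤0}} lo≤k) at-lo

  -- What is kept of a sum `x` of `k` out of `M` entries between `v` and `u` with total `S`. The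
  -- field `x-tail` says that the `M - k` entries left out are each at least `v`.
  record PartialSum (S u v M k x : ℤ) : Set where
    field
      0≤k    : 0ℤ ≤ k
      k≤M    : k ≤ M
      x≤S    : x ≤ S
      x≤uk   : x ≤ u * k
      x-tail : x + v * M ≤ S + v * k

  -- The sequence of length M with t entries u, one entry v + ρ and the remaining ones v.
  record Staircase (S u v M t ρ : ℤ) : Set where
    field
      ρ-def : ρ ≡ S - u * t - v * (M - t)
      0≤t   : 0ℤ ≤ t
      t≤M   : t ≤ M
      0≤v   : 0ℤ ≤ v
      0≤ρ   : 0ℤ ≤ ρ
      v+ρ≤u : v + ρ ≤ u

  -- For `k ≤ t` use `y ≤ u * k` and interpolate between 0 and `t`; beyond that use the tail bound
  -- and interpolate between `1 + t` and `M`. At `1 + t` the tail bound on `y` equals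
  -- `u * t + (v + ρ)`, the sum of the first `1 + t` staircase entries.
  sideBound : ∀ S x κ {u v M t ρ k y} → ρ ≡ S - u * t - v * (M - t) → PartialSum S u v M k y →
    x ≤ S → x + u * t ≤ S + κ * t →
    (1ℤ + t ≤ M → x + (u * t + (v + ρ)) ≤ S + κ * (1ℤ + t)) → x ≤ κ * M →
    x + y ≤ S + κ * k
  sideBound S x κ {u} {v} {M} {t} {_} {k} {y} refl part at-0 at-t at-1+t at-M with k ≤? t
  ... | yes k≤t = ≤-combine (eq₃ S x κ u k y) x≤uk
    (interpolate (u - κ) {S - x} 0≤k k≤t (≤-shift (eq₁ S x κ u) at-0) (≤-shift (eq₂ S x κ u t) at-t))
    where
    open PartialSum part
    eq₁ : ∀ S x κ u → S - x ≡ (S - x) - (u - κ) * 0ℤ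
    eq₁ = solve-∀
    eq₂ : ∀ S x κ u t → (S + κ * t) - (x + u * t) ≡ (S - x) - (u - κ) * t
    eq₂ = solve-∀
    eq₃ : ∀ S x κ u k y → (u * k - y) + ((S - x) - (u - κ) * k) ≡ (S + κ * k) - (x + y)
    eq₃ = solve-∀
  ... | no k≰t = ≤-combine (eq₃ S x κ v M k y) x-tail
    (interpolate (v - κ) {v * M - x} 1+t≤k k≤M
      (≤-shift (eq₁ S x κ u v M t) (at-1+t (≤-trans 1+t≤k k≤M))) (≤-shift (eq₂ x κ v M) at-M))
    where
    open PartialSum part
    1+t≤k : 1ℤ + t ≤ k
    1+t≤k = i<j⇒suc[i]≤j (≰⇒> k≰t)
    eq₁ : ∀ S x κ u v M t → (S + κ * (1ℤ + t)) - (x + (u * t + (v + (S - u * t - v * (M - t)))))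
                            ≡ (v * M - x) - (v - κ) * (1ℤ + t)
    eq₁ = solve-∀
    eq₂ : ∀ x κ v M → κ * M - x ≡ (v * M - x) - (v - κ) * M
    eq₂ = solve-∀
    eq₃ : ∀ S x κ v M k y → ((S + v * k) - (y + v * M)) + ((v * M - x) - (v - κ) * k)
                            ≡ (S + κ * k) - (x + y)
    eq₃ = solve-∀

  record Corners (S a b r q c d s p : ℤ) : Set where
    field
      rs   : a * r + c * s ≤ S + r * s
      rs⁺  : a * r + (c * s + (d + p)) ≤ S + r * (1ℤ + s)
      r⁺s  : (a * r + (b + q)) + c * s ≤ S + (1ℤ + r) * s
      r⁺s⁺ : (a * r + (b + q)) + (c * s + (d + p)) ≤ S + (1ℤ + r) * (1ℤ + s)

  -- The excess x + y - S - kl is bounded by a function that is affine in each of k and l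
  -- on each cell of the grid {0, r, r + 1, m} × {0, s, s + 1, n}, so only the grid points matter.
  cornerBound : ∀ {S a b m r q c d n s p k x l y} →
    Staircase S a b m r q → Staircase S c d n s p → a ≤ n → c ≤ m →
    Corners S a b r q c d s p →
    PartialSum S a b m k x → PartialSum S c d n l y →
    x + y ≤ S + k * l
  cornerBound {S} {a} {b} {m} {r} {q} {c} {d} {n} {s} {p} {k} {x} {l} {y} A C a≤n c≤m corners X Y =
    -- First `k` varies while `l` and `y` stay fixed. The bounds this needs at `r` and `1 + r` come
    -- from a second use of `sideBound`, where `l` varies and the first side is fixed at its
    -- staircase value.
    subst₂ _≤_ (+-comm y x) (cong (λ z → S + z) (*-comm l k))
      (sideBound S y l A.ρ-def X Y.x≤S at-r at-1+r y≤lm)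
    where
    module A = Staircase A
    module C = Staircase C
    module Y = PartialSum Y
    open Corners corners

    y≤lm : y ≤ l * m
    y≤lm = ≤-trans Y.x≤uk (subst (_≤ l * m) (*-comm l c) (*-monoˡ-0≤ Y.0≤k c≤m))

    ar≤S : a * r ≤ S
    ar≤S = ≤-combine (trans (cong (λ q → (q - 0ℤ) + (b * m - b * r)) A.ρ-def) (eq S a b m r))
                     A.0≤ρ (*-monoˡ-0≤ A.0≤v A.t≤M)
      where
      eq : ∀ S a b m r → (S - a * r - b * (m - r) - 0ℤ) + (b * m - b * r) ≡ S - a * r
      eq = solve-∀

    ar≤rn : a * r ≤ r * n
    ar≤rn = subst (_≤ r * n) (*-comm r a) (*-monoˡ-0≤ A.0≤t a≤n)

    at-r : y + a * r ≤ S + l * r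
    at-r = subst₂ _≤_ (+-comm (a * r) y) (cong (λ z → S + z) (*-comm r l))
      (sideBound S (a * r) r C.ρ-def Y ar≤S rs (const rs⁺) ar≤rn)

    -- After `1 + r` staircase entries the rest of `S` is `b * (m - (1 + r))`, which is nonnegative
    -- only if that many entries exist.
    next≤S : 1ℤ + r ≤ m → a * r + (b + q) ≤ S
    next≤S r<m = ≤-shift (trans (eq S a b m r) (cong (λ q → S - (a * r + (b + q))) (sym A.ρ-def)))
                         (*-monoˡ-0≤ A.0≤v r<m)
      where
      eq : ∀ S a b m r → b * m - b * (1ℤ + r) ≡ S - (a * r + (b + (S - a * r - b * (m - r))))
      eq = solve-∀

    next≤1+rn : a * r + (b + q) ≤ (1ℤ + r) * n
    next≤1+rn = ≤-combine (eq a b r q n) A.v+ρ≤u (*-monoˡ-0≤ (≤-trans A.0≤t (i≤suc[i] r)) a≤n)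
      where
      eq : ∀ a b r q n → (a - (b + q)) + ((1ℤ + r) * n - (1ℤ + r) * a)
                         ≡ (1ℤ + r) * n - (a * r + (b + q))
      eq = solve-∀

    at-1+r : 1ℤ + r ≤ m → y + (a * r + (b + q)) ≤ S + l * (1ℤ + r)
    at-1+r r<m = subst₂ _≤_ (+-comm (a * r + (b + q)) y) (cong (λ z → S + z) (*-comm (1ℤ + r) l))
      (sideBound S (a * r + (b + q)) (1ℤ + r) C.ρ-def Y (next≤S r<m) r⁺s (const r⁺s⁺) next≤1+rn)

  -- With one side constant, `x ≤ a * k` bounds the excess by a function affine in `k` on the whole
  -- range from 0 to `m`. At 0 it needs `y ≤ S`; at `m` it needs `a * m ≤ S` and
  -- `y ≤ c * l ≤ l * m`.
  constantBound : ∀ {S a m c d n k x l y} → a * m ≤ S → c ≤ m →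
    PartialSum S a a m k x → PartialSum S c d n l y → x + y ≤ S + k * l
  constantBound {S} {a} {m} {c} {_} {_} {k} {x} {l} {y} am≤S c≤m X Y =
    ≤-combine (eq₃ S a k x l y) X.x≤uk
      (interpolate (a - l) {S - y} X.0≤k X.k≤M (≤-shift (eq₁ S a l y) Y.x≤S)
        (≤-combine (eq₂ S a m l y) am≤S (≤-trans Y.x≤uk (subst (_≤ l * m) (*-comm l c) (*-monoˡ-0≤ Y.0≤k c≤m)))))
    where
    module X = PartialSum X
    module Y = PartialSum Y
    eq₁ : ∀ S a l y → S - y ≡ (S - y) - (a - l) * 0ℤ
    eq₁ = solve-∀
    eq₂ : ∀ S a m l y → (S - a * m) + (l * m - y) ≡ (S - y) - (a - l) * m
    eq₂ = solve-∀
    eq₃ : ∀ S a k x l y → (a * k - x) + ((S - y) - (a - l) * k) ≡ (S + k * l) - (x + y)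
    eq₃ = solve-∀

  module _ (S a b r q c d s p : ℤ) where

    private
      min : ℤ
      min = (r - p - d) ⊓ (s - q - b) ⊓ (r + s - p - q - b - d + 1ℤ) ⊓ 0ℤ

      excess : ℤ
      excess = (a * r + c * s) - (S + r * s)

      rs-eq : ∀ S a r c s → (S + r * s) - (a * r + c * s) ≡ 0ℤ - ((a * r + c * s) - (S + r * s))
      rs-eq = solve-∀
      rs⁺-eq : ∀ S a r c d s p → (S + r * (1ℤ + s)) - (a * r + (c * s + (d + p)))
               ≡ (r - p - d) - ((a * r + c * s) - (S + r * s))
      rs⁺-eq = solve-∀
      r⁺s-eq : ∀ S a b r q c s → (S + (1ℤ + r) * s) - ((a * r + (b + q)) + c * s)
               ≡ (s - q - b) - ((a * r + c * s) - (S + r * s))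
      r⁺s-eq = solve-∀
      r⁺s⁺-eq : ∀ S a b r q c d s p →
                (S + (1ℤ + r) * (1ℤ + s)) - ((a * r + (b + q)) + (c * s + (d + p)))
                ≡ (r + s - p - q - b - d + 1ℤ) - ((a * r + c * s) - (S + r * s))
      r⁺s⁺-eq = solve-∀
      excess-eq : ∀ S a r c s μ → (S + r * s + μ) - (a * r + c * s) ≡ μ - ((a * r + c * s) - (S + r * s))
      excess-eq = solve-∀

    -- The slack at each corner is one of the four terms of `min` minus the common `excess`, so the
    -- four corner bounds together say `excess ≤ min`.
    corners⇒minimum : Corners S a b r q c d s p → a * r + c * s ≤ S + r * s + min
    corners⇒minimum corners = ≤-shift (sym (excess-eq S a r c s min))
      (⊓-glb (⊓-glb (⊓-glb (≤-shift {excess} {r - p - d} (rs⁺-eq S a r c d s p) rs⁺) (≤-shift {excess} {s - q - b} (r⁺s-eq S a b r q c s) r⁺s))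
                    (≤-shift {excess} {r + s - p - q - b - d + 1ℤ} (r⁺s⁺-eq S a b r q c d s p) r⁺s⁺))
             (≤-shift {excess} {0ℤ} (rs-eq S a r c s) rs))
      where open Corners corners

    minimum⇒corners : a * r + c * s ≤ S + r * s + min → Corners S a b r q c d s p
    minimum⇒corners bound = record
      { rs   = ≤-shift (sym (rs-eq S a r c s)) (≤-trans excess≤min (i⊓j≤j _ _))
      ; rs⁺  = ≤-shift (sym (rs⁺-eq S a r c d s p))
                 (≤-trans excess≤min (≤-trans (i⊓j≤i _ _) (≤-trans (i⊓j≤i _ _) (i⊓j≤i _ _))))
      ; r⁺s  = ≤-shift (sym (r⁺s-eq S a b r q c s))
                 (≤-trans excess≤min (≤-trans (i⊓j≤i _ _) (≤-trans (i⊓j≤i _ _) (i⊓j≤j (r - p - d) _))))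
      ; r⁺s⁺ = ≤-shift (sym (r⁺s⁺-eq S a b r q c d s p))
                 (≤-trans excess≤min (≤-trans (i⊓j≤i _ _) (i⊓j≤j ((r - p - d) ⊓ (s - q - b)) _)))
      }
      where
      excess≤min : excess ≤ min
      excess≤min = ≤-shift {excess} {min} (excess-eq S a r c s min) bound

open IntegerBounds using (PartialSum; Staircase; Corners; cornerBound; constantBound; corners⇒minimum; minimum⇒corners)
open import Data.Nat using (ℕ; zero; suc; NonZero; >-nonZero; _+_; _*_; _∸_; _≤_; _<_; _≥_; _≤ᵇ_; _⊔_; _⊓_; z≤n; s≤s; s≤s⁻¹)
open import Data.Nat.DivMod using (_%_; m≡m%n+[m/n]*n; m%n<n)
open import Data.Nat.Properties
open import Data.Nat.Tactic.RingSolver using (solve-∀)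
open import Algebra.Properties.Monoid.Sum ℤₚ.+-0-monoid using () renaming (sum to sumℤ; sum-cong-≗ to sumℤ-cong)
open import Algebra.Properties.Semiring.Sum +-*-semiring
  using (sum; sum-cong-≗; sum-replicate-zero; ∑-distrib-+; ∑-comm; *-distribˡ-sum)

private variable
  m n : ℕ

-- Sums over subsets encoded as Boolean vectors.

χ : Bool → ℕ
χ true  = 1
χ false = 0

card : Vector Bool n → ℕ
card K = sum (χ ∘ K)

sumOver : Vector Bool n → Vector ℕ n → ℕ
sumOver K v = sum (λ i → χ (K i) * v i)

sum-mono : {v w : Vector ℕ n} → (∀ i → v i ≤ w i) → sum v ≤ sum w
sum-mono {zero}  v≤w = z≤n
sum-mono {suc n} v≤w = +-mono-≤ (v≤w zero) (sum-mono (v≤w ∘ suc))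

sum-zero : {v : Vector ℕ n} → (∀ i → v i ≡ 0) → sum v ≡ 0
sum-zero {n} v≗0 = trans (sum-cong-≗ v≗0) (sum-replicate-zero n)

term≤sum : (v : Vector ℕ n) (i : Fin n) → v i ≤ sum v
term≤sum v zero    = m≤m+n _ _
term≤sum v (suc i) = ≤-trans (term≤sum (tail v) i) (m≤n+m _ _)

-- Selection of the largest entries and the Gale-Ryser theorem.

infix 4 _⊑_
_⊑_ : Vector Bool n → Vector Bool n → Set
K ⊑ L = ∀ i → K i ≡ true → L i ≡ true

-- If `t` equals `card L`, take `L`. Otherwise there is a surplus: a first position in `L` but not
-- in `K` is dropped, one in both is kept and counted against `t`.
intermediateSubset : {K L : Vector Bool n} (t : ℕ) → K ⊑ L → card K ≤ t → t ≤ card L →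
  ∃[ T ] card T ≡ t × K ⊑ T × T ⊑ L
intermediateSubset {zero} {L = L} t K⊑L _ t≤0 = L , sym (n≤0⇒n≡0 t≤0) , K⊑L , λ _ p → p
intermediateSubset {suc n} {K} {L} t K⊑L K≤t t≤L with m≤n⇒m<n∨m≡n t≤L
... | inj₂ refl = L , refl , K⊑L , λ _ p → p
... | inj₁ t<L with K zero in K₀ | L zero in L₀
...   | true | false = contradiction (trans (sym L₀) (K⊑L zero K₀)) λ ()
...   | false | false =
  let T , T≡t , K⊑T , T⊑L = intermediateSubset {K = tail K} {tail L} t (K⊑L ∘ suc) K≤t t≤L
  in false ∷ T , T≡t
   , (λ { zero p → trans (sym K₀) p ; (suc i) → K⊑T i })
   , (λ { zero () ; (suc i) → T⊑L i })
...   | false | true =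
  let T , T≡t , K⊑T , T⊑L = intermediateSubset {K = tail K} {tail L} t (K⊑L ∘ suc) K≤t (s≤s⁻¹ t<L)
  in false ∷ T , T≡t
   , (λ { zero p → trans (sym K₀) p ; (suc i) → K⊑T i })
   , (λ { zero () ; (suc i) → T⊑L i })
intermediateSubset {suc n} {K} {L} (suc t) K⊑L K≤t t≤L | inj₁ t<L | true | true =
  let T , T≡t , K⊑T , T⊑L = intermediateSubset {K = tail K} {tail L} t (K⊑L ∘ suc) (s≤s⁻¹ K≤t) (s≤s⁻¹ t≤L)
  in true ∷ T , cong suc T≡t
   , (λ { zero _ → refl ; (suc i) → K⊑T i })
   , (λ { zero _ → L₀ ; (suc i) → T⊑L i })

-- Discrete intermediate value argument, searching downwards from `suc B`.
crossing : (g : ℕ → ℕ) (s B : ℕ) → s ≤ g 0 → g (suc B) ≤ s → ∃[ t ] s ≤ g t × g (suc t) ≤ s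
crossing g s zero    s≤g₀ g≤s = 0 , s≤g₀ , g≤s
crossing g s (suc B) s≤g₀ g≤s with ≤-total s (g (suc B))
... | inj₁ s≤g = suc B , s≤g , g≤s
... | inj₂ g≤s′ = crossing g s B s≤g₀ g≤s′

above : ℕ → Vector ℕ n → Vector Bool n
above t v i = suc t ≤ᵇ v i

above⇒< : ∀ t (v : Vector ℕ n) i → above t v i ≡ true → t < v i
above⇒< t v i p = ≤ᵇ⇒≤ (suc t) (v i) (subst T (sym p) _)

<⇒above : ∀ t (v : Vector ℕ n) i → t < v i → above t v i ≡ true
<⇒above t v i t<v with above t v i | ≤⇒≤ᵇ t<v
... | true | _ = refl

¬above⇒≥ : ∀ t (v : Vector ℕ n) i → above t v i ≡ false → v i ≤ t
¬above⇒≥ t v i p = ≮⇒≥ λ t<v → contradiction (trans (sym p) (<⇒above t v i t<v)) λ ()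

-- At the level `t` where the number of entries above the level crosses `s`, squeeze `T` between the
-- entries above `suc t` and those above `t`. Thus `T` holds `s` largest entries, with only ties at
-- `suc t` left open. No entry exceeds `suc (sum v)`, so the crossing exists.
topSubset : (v : Vector ℕ n) (s : ℕ) → s ≤ card (above 0 v) →
  ∃₂ λ T t → card T ≡ s
           × (∀ i → T i ≡ true → t < v i)
           × (∀ i → T i ≡ false → v i ≤ suc t)
topSubset v s s≤ =
  let t , s≤g , g≤s = crossing (λ t → card (above t v)) s (sum v) s≤
        (≤-trans (≤-reflexive (sum-zero above-sum)) z≤n)
      T , T≡s , lo , hi = intermediateSubset s (nested t) g≤s s≤g
  in T , t , T≡s
   , (λ i p → above⇒< t v i (hi i p))
   , (λ i p → ≮⇒≥ λ t<v → contradiction (trans (sym p) (lo i (<⇒above (suc t) v i t<v))) λ ())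
  where
  above-sum : ∀ i → χ (above (suc (sum v)) v i) ≡ 0
  above-sum i with above (suc (sum v)) v i in eq
  ... | false = refl
  ... | true  = contradiction (≤-trans (above⇒< (suc (sum v)) v i eq) (term≤sum v i))
                              (<⇒≱ (n≤1+n _))
  nested : ∀ t → above (suc t) v ⊑ above t v
  nested t i p = <⇒above t v i (<⇒≤ (above⇒< (suc t) v i p))

-- Gale–Ryser; the condition is the one with Σ_j min(f_j, |K|) = min_L (|K||L| + Σ_{j ∉ L} f_j).
-- The first row is joined to the e₀ columns of largest demand f_j.
galeRyser : (e : Vector ℕ m) (f : Vector ℕ n) → sum e ≡ sum f →
  (∀ K → sumOver K e ≤ sum (λ j → f j ⊓ card K)) →
  ∃ λ (A : Fin m → Fin n → Bool) → (∀ i → e i ≡ card (A i)) × (∀ j → f j ≡ card (λ i → A i j))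
galeRyser {zero} e f e≡f dom =
  (λ ()) , (λ ()) , λ j → n≤0⇒n≡0 (≤-trans (term≤sum f j) (≤-reflexive (sym e≡f)))
galeRyser {suc m} {n} e f e≡f dom = extend (topSubset f (e zero) e₀≤support)
  where
  open ≤-Reasoning

  ⊓1≤χ : ∀ j → f j ⊓ 1 ≤ χ (above 0 f j)
  ⊓1≤χ j with f j
  ... | zero  = z≤n
  ... | suc _ = s≤s (≤-reflexive (⊓-zeroʳ _))

  -- The condition for the first row alone provides enough columns of positive demand.
  e₀≤support : e zero ≤ card (above 0 f)
  e₀≤support = begin
    e zero                                     ≤⟨ ≤-trans (≤-reflexive (sym (+-identityʳ _))) (m≤m+n _ _) ⟩
    sumOver (true ∷ const false) e             ≤⟨ dom (true ∷ const false) ⟩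
    sum (λ j → f j ⊓ suc (card {m} (const false))) ≡⟨ cong (λ c → sum (λ j → f j ⊓ suc c)) (sum-replicate-zero m) ⟩
    sum (λ j → f j ⊓ 1)                        ≤⟨ sum-mono ⊓1≤χ ⟩
    card (above 0 f)                           ∎

  extend : (∃₂ λ T t → card T ≡ e zero
                     × (∀ i → T i ≡ true → t < f i)
                     × (∀ i → T i ≡ false → f i ≤ suc t)) →
    ∃ λ (A : Fin (suc m) → Fin n → Bool) →
      (∀ i → e i ≡ card (A i)) × (∀ j → f j ≡ card (λ i → A i j))
  extend (T , t , T≡e₀ , inT , outT) =
    let A , rows , cols = galeRyser (tail e) f′ e′≡f′ dom′
    in T ∷ A
     , (λ { zero → sym T≡e₀ ; (suc i) → rows i })
     , λ j → trans (sym (split j)) (cong (_+_ (χ (T j))) (cols j))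
    where
    f′ : Vector ℕ n
    f′ j = f j ∸ χ (T j)

    split : ∀ j → χ (T j) + f′ j ≡ f j
    split j with T j in eq
    ... | false = refl
    -- A chosen column has demand above `t`, hence at least 1, so the subtraction in `f′` is exact.
    ... | true  = m+[n∸m]≡n (≤-trans (s≤s z≤n) (inT j eq))

    e′≡f′ : sum (tail e) ≡ sum f′
    e′≡f′ = +-cancelˡ-≡ (e zero) _ _ (begin-equality
      e zero + sum (tail e)              ≡⟨ e≡f ⟩
      sum f                              ≡⟨ sum-cong-≗ split ⟨
      sum (λ j → χ (T j) + f′ j)         ≡⟨ ∑-distrib-+ (χ ∘ T) f′ ⟩
      card T + sum f′                    ≡⟨ cong (_+ sum f′) T≡e₀ ⟩
      e zero + sum f′                    ∎)

    -- If |K| ≤ t, removing T does not change min(f_j, |K|) ...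
    low : ∀ {k} → k ≤ t → ∀ j → f j ⊓ k ≤ f′ j ⊓ k
    low {k} k≤t j with T j in eq
    ... | false = ≤-refl
    ... | true  = ≤-trans (m⊓n≤n (f j) k)
                    (≤-reflexive (sym (m≥n⇒m⊓n≡n (∸-monoˡ-≤ 1 (≤-trans (s≤s k≤t) (inT j eq))))))

    -- ... and otherwise the condition for K with the first row added gives it for K.
    high : ∀ {k} → t < k → ∀ j → f j ⊓ suc k ≤ χ (T j) + f′ j ⊓ k
    high {k} t<k j with T j in eq | split j
    ... | false | _ = ≤-trans (m⊓n≤m (f j) (suc k)) (≤-reflexive (sym (m≤n⇒m⊓n≡m (≤-trans (outT j eq) t<k))))
    ... | true  | s = ≤-reflexive (cong (_⊓ suc k) (sym s))

    dom′ : ∀ K → sumOver K (tail e) ≤ sum (λ j → f′ j ⊓ card K)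
    dom′ K with ≤-<-connex (card K) t
    ... | inj₁ k≤t = ≤-trans (dom (false ∷ K)) (sum-mono (low k≤t))
    ... | inj₂ t<k = +-cancelˡ-≤ (e zero) _ _ (begin
      e zero + sumOver K (tail e)                 ≡⟨ cong (_+ sumOver K (tail e)) (sym (+-identityʳ (e zero))) ⟩
      sumOver (true ∷ K) e                        ≤⟨ dom (true ∷ K) ⟩
      sum (λ j → f j ⊓ suc (card K))              ≤⟨ sum-mono (high t<k) ⟩
      sum (λ j → χ (T j) + f′ j ⊓ card K)         ≡⟨ ∑-distrib-+ (χ ∘ T) _ ⟩
      card T + sum (λ j → f′ j ⊓ card K)          ≡⟨ cong (_+ sum (λ j → f′ j ⊓ card K)) T≡e₀ ⟩
      e zero + sum (λ j → f′ j ⊓ card K)          ∎)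

-- Bounds on subset sums and cut inequalities.

∣tabulate∣ : (K : Vector Bool n) → Subset.∣ tabulate K ∣ ≡ card K
∣tabulate∣ {zero}  K = refl
∣tabulate∣ {suc n} K with K zero
... | true  = cong suc (∣tabulate∣ (tail K))
... | false = ∣tabulate∣ (tail K)

sum-const : ∀ n v → sum {n} (const v) ≡ n * v
sum-const zero    v = refl
sum-const (suc n) v = cong (_+_ v) (sum-const n v)

χ≤1 : ∀ b → χ b ≤ 1
χ≤1 true  = ≤-refl
χ≤1 false = z≤n

card≤n : (K : Vector Bool n) → card K ≤ n
card≤n {n} K = ≤-trans (sum-mono (χ≤1 ∘ K)) (≤-reflexive (trans (sum-const n 1) (*-identityʳ n)))

sumOver≤sum : (K : Vector Bool n) (v : Vector ℕ n) → sumOver K v ≤ sum v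
sumOver≤sum K v = sum-mono λ i → ≤-trans (*-monoˡ-≤ (v i) (χ≤1 (K i))) (≤-reflexive (*-identityˡ (v i)))

sumOver-upper : (K : Vector Bool n) {v : Vector ℕ n} {u : ℕ} → (∀ i → v i ≤ u) →
  sumOver K v ≤ u * card K
sumOver-upper K {v} {u} v≤u = ≤-trans
  (sum-mono λ i → ≤-trans (*-monoʳ-≤ (χ (K i)) (v≤u i)) (≤-reflexive (*-comm (χ (K i)) u)))
  (≤-reflexive (sym (*-distribˡ-sum u (χ ∘ K))))

-- Each position outside `K` carries at least `l`. The additive form avoids truncated subtraction.
sumOver-tail : (K : Vector Bool n) {v : Vector ℕ n} {l : ℕ} → (∀ i → l ≤ v i) →
  sumOver K v + l * n ≤ sum v + l * card K
sumOver-tail {n} K {v} {l} l≤v = begin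
  sumOver K v + l * n                    ≡⟨ cong (_+_ (sumOver K v)) (trans (*-comm l n) (sym (sum-const n l))) ⟩
  sumOver K v + sum {n} (const l)        ≡⟨ ∑-distrib-+ (λ i → χ (K i) * v i) (const l) ⟨
  sum (λ i → χ (K i) * v i + l)          ≤⟨ sum-mono pointwise ⟩
  sum (λ i → v i + l * χ (K i))          ≡⟨ ∑-distrib-+ v (λ i → l * χ (K i)) ⟩
  sum v + sum (λ i → l * χ (K i))        ≡⟨ cong (_+_ (sum v)) (*-distribˡ-sum l (χ ∘ K)) ⟨
  sum v + l * card K                     ∎
  where
  open ≤-Reasoning
  pointwise : ∀ i → χ (K i) * v i + l ≤ v i + l * χ (K i)
  pointwise i with K i
  ... | true  = ≤-reflexive (cong₂ _+_ (*-identityˡ (v i)) (sym (*-identityʳ l)))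
  ... | false = ≤-trans (l≤v i) (m≤m+n _ _)

-- The sharpest cut takes for `L` the columns with `f j` above `k`; there the two sides of the
-- conversion agree term by term.
cuts⇒dominance : (f : Vector ℕ n) (k x : ℕ) →
  (∀ L → x + sumOver L f ≤ sum f + k * card L) → x ≤ sum (λ j → f j ⊓ k)
cuts⇒dominance f k x cut = +-cancelʳ-≤ (sumOver L f) _ _ (begin
  x + sumOver L f                        ≤⟨ cut L ⟩
  sum f + k * card L                     ≡⟨ cong (_+_ (sum f)) (*-distribˡ-sum k (χ ∘ L)) ⟩
  sum f + sum (λ j → k * χ (L j))        ≡⟨ ∑-distrib-+ f (λ j → k * χ (L j)) ⟨
  sum (λ j → f j + k * χ (L j))          ≡⟨ sum-cong-≗ pointwise ⟩
  sum (λ j → f j ⊓ k + χ (L j) * f j)    ≡⟨ ∑-distrib-+ (λ j → f j ⊓ k) (λ j → χ (L j) * f j) ⟩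
  sum (λ j → f j ⊓ k) + sumOver L f      ∎)
  where
  open ≤-Reasoning
  L = above k f
  pointwise : ∀ j → f j + k * χ (L j) ≡ f j ⊓ k + χ (L j) * f j
  pointwise j with L j in eq
  ... | true  = trans (+-comm (f j) (k * 1)) (cong₂ _+_
                  (trans (*-identityʳ k) (sym (m≥n⇒m⊓n≡n (<⇒≤ (above⇒< k f j eq)))))
                  (sym (*-identityˡ (f j))))
  ... | false = cong₂ _+_ (sym (m≤n⇒m⊓n≡m (¬above⇒≥ k f j eq))) (*-zeroʳ k)

-- Count cell by cell: an edge is counted twice on the left only inside the rectangle `K` × `L`, and
-- each cell of that rectangle contributes an extra 1 on the right.
edgeCount : (A : Fin m → Fin n → Bool) (K : Vector Bool m) (L : Vector Bool n) →
  sumOver K (card ∘ A) + sumOver L (λ j → card (λ i → A i j)) ≤ sum (card ∘ A) + card K * card L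
edgeCount {m} {n} A K L = begin
  sumOver K (card ∘ A) + sumOver L (λ j → card (λ i → A i j))
    ≡⟨ cong₂ _+_ (sum-cong-≗ λ i → *-distribˡ-sum (χ (K i)) (χ ∘ A i))
                 (sum-cong-≗ λ j → *-distribˡ-sum (χ (L j)) (λ i → χ (A i j))) ⟩
  sum (λ i → sum (λ j → χ (K i) * χ (A i j))) + sum (λ j → sum (λ i → χ (L j) * χ (A i j)))
    ≡⟨ cong (_+_ (sum (λ i → sum (λ j → χ (K i) * χ (A i j))))) (∑-comm (λ j i → χ (L j) * χ (A i j))) ⟩
  sum (λ i → sum (λ j → χ (K i) * χ (A i j))) + sum (λ i → sum (λ j → χ (L j) * χ (A i j)))
    ≡⟨ sum₂-distrib (λ i j → χ (K i) * χ (A i j)) (λ i j → χ (L j) * χ (A i j)) ⟨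
  sum (λ i → sum (λ j → χ (K i) * χ (A i j) + χ (L j) * χ (A i j)))
    ≤⟨ sum-mono (λ i → sum-mono (λ j → pointwise (A i j) (K i) (L j))) ⟩
  sum (λ i → sum (λ j → χ (A i j) + χ (K i) * χ (L j)))
    ≡⟨ sum₂-distrib (λ i j → χ (A i j)) (λ i j → χ (K i) * χ (L j)) ⟩
  sum (card ∘ A) + sum (λ i → sum (λ j → χ (K i) * χ (L j)))
    ≡⟨ cong (_+_ (sum (card ∘ A))) (sum-cong-≗ λ i → trans (sym (*-distribˡ-sum (χ (K i)) (χ ∘ L))) (*-comm (χ (K i)) (card L))) ⟩
  sum (card ∘ A) + sum (λ i → card L * χ (K i))
    ≡⟨ cong (_+_ (sum (card ∘ A))) (trans (sym (*-distribˡ-sum (card L) (χ ∘ K))) (*-comm (card L) (card K))) ⟩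
  sum (card ∘ A) + card K * card L
    ∎
  where
  open ≤-Reasoning
  sum₂-distrib : (g h : Fin m → Fin n → ℕ) →
    sum (λ i → sum (λ j → g i j + h i j)) ≡ sum (λ i → sum (g i)) + sum (λ i → sum (h i))
  sum₂-distrib g h = trans (sum-cong-≗ λ i → ∑-distrib-+ (g i) (h i)) (∑-distrib-+ (sum ∘ g) (sum ∘ h))
  pointwise : ∀ x y z → χ y * χ x + χ z * χ x ≤ χ x + χ y * χ z
  pointwise true  true  true  = ≤-refl
  pointwise true  true  false = ≤-refl
  pointwise true  false true  = ≤-refl
  pointwise true  false false = z≤n
  pointwise false true  z     = ≤-trans (≤-reflexive (*-zeroʳ (χ z))) z≤n
  pointwise false false z     = ≤-trans (≤-reflexive (*-zeroʳ (χ z))) z≤n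

-- Sequences with prescribed extremes, and staircases.

record HasExtremes (u v S : ℕ) (e : Vector ℕ n) : Set where
  field
    total  : sum e ≡ S
    max-at : ∃[ i ] e i ≡ u
    ≤max   : ∀ i → e i ≤ u
    min-at : ∃[ i ] e i ≡ v
    min≤   : ∀ i → v ≤ e i

staircase : (u x v n t : ℕ) → Vector ℕ n
staircase u x v zero    _       = []
staircase u x v (suc n) zero    = x ∷ const v
staircase u x v (suc n) (suc t) = u ∷ staircase u x v n t

firsts : (n t : ℕ) → Vector Bool n
firsts zero    _       = []
firsts (suc n) zero    = const false
firsts (suc n) (suc t) = true ∷ firsts n t

card-firsts : ∀ {n t} → t ≤ n → card (firsts n t) ≡ t
card-firsts {zero}  z≤n       = refl
card-firsts {suc n} z≤n       = sum-zero {suc n} λ _ → refl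
card-firsts         (s≤s t≤n) = cong suc (card-firsts t≤n)

sum-staircase : ∀ u x v {n t} → t < n →
  sum (staircase u x v n t) + suc t * v ≡ t * u + x + n * v
sum-staircase u x v {suc n} {zero} _ =
  trans (cong (λ σ → x + σ + (v + 0)) (sum-const n v)) (eq x v n)
  where
  eq : ∀ x v n → x + n * v + (v + 0) ≡ x + (v + n * v)
  eq = solve-∀
sum-staircase u x v {suc n} {suc t} (s≤s t<n) =
  trans (eq₁ u _ v (suc t * v)) (trans (cong (λ σ → u + (v + σ)) (sum-staircase u x v t<n)) (eq₂ u x v (n * v) (t * u)))
  where
  eq₁ : ∀ u σ v τ → u + σ + (v + τ) ≡ u + (v + (σ + τ))
  eq₁ = solve-∀
  eq₂ : ∀ u x v ν τ → u + (v + (τ + x + ν)) ≡ u + τ + x + (v + ν)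
  eq₂ = solve-∀

sumOver-∅ : (v : Vector ℕ n) → sumOver (const false) v ≡ 0
sumOver-∅ v = sum-zero {v = λ i → 0 * v i} λ _ → refl

sumOver-firsts : ∀ u x v {n t} → t < n → sumOver (firsts n t) (staircase u x v n t) ≡ t * u
sumOver-firsts u x v {suc n} {zero}  _         = sumOver-∅ (staircase u x v (suc n) zero)
sumOver-firsts u x v {suc n} {suc t} (s≤s t<n) =
  cong₂ _+_ (*-identityˡ u) (sumOver-firsts u x v t<n)

sumOver-firsts-suc : ∀ u x v {n t} → t < n →
  sumOver (firsts n (suc t)) (staircase u x v n t) ≡ t * u + x
sumOver-firsts-suc u x v {suc zero}    {zero}  _ = trans (+-identityʳ _) (*-identityˡ x)
sumOver-firsts-suc u x v {suc (suc n)} {zero}  _ =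
  trans (cong₂ _+_ (*-identityˡ x) (sumOver-∅ {suc n} (const v))) (+-identityʳ x)
sumOver-firsts-suc u x v {suc n} {suc t} (s≤s t<n) =
  trans (cong₂ _+_ (*-identityˡ u) (sumOver-firsts-suc u x v t<n)) (sym (+-assoc u _ x))

staircase-≤ : ∀ {u x v} n t → x ≤ u → v ≤ u → ∀ i → staircase u x v n t i ≤ u
staircase-≤ (suc n) zero    x≤u v≤u zero    = x≤u
staircase-≤ (suc n) zero    x≤u v≤u (suc i) = v≤u
staircase-≤ (suc n) (suc t) x≤u v≤u zero    = ≤-refl
staircase-≤ (suc n) (suc t) x≤u v≤u (suc i) = staircase-≤ n t x≤u v≤u i

staircase-≥ : ∀ {u x v} n t → v ≤ x → v ≤ u → ∀ i → v ≤ staircase u x v n t i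
staircase-≥ (suc n) zero    v≤x v≤u zero    = v≤x
staircase-≥ (suc n) zero    v≤x v≤u (suc i) = ≤-refl
staircase-≥ (suc n) (suc t) v≤x v≤u zero    = v≤u
staircase-≥ (suc n) (suc t) v≤x v≤u (suc i) = staircase-≥ n t v≤x v≤u i

staircase-max : ∀ u x v {n t} → t < n → 0 < t → ∃[ i ] staircase u x v n t i ≡ u
staircase-max u x v {suc n} {suc t} _ _ = zero , refl

-- The minimum is attained by the intermediate entry itself or by some entry after it.
staircase-min : ∀ u x v {n t} → t < n → x ≡ v ⊎ suc t < n → ∃[ i ] staircase u x v n t i ≡ v
staircase-min u x v {suc n}       {zero}  _ (inj₁ x≡v) = zero , x≡v
staircase-min u x v {suc zero}    {zero}  _ (inj₂ (s≤s ()))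
staircase-min u x v {suc (suc n)} {zero}  _ (inj₂ _) = suc zero , refl
staircase-min u x v {suc n} {suc t} (s≤s t<n) (inj₁ x≡v) =
  let i , eq = staircase-min u x v t<n (inj₁ x≡v) in suc i , eq
staircase-min u x v {suc n} {suc t} (s≤s t<n) (inj₂ (s≤s 1+t<n)) =
  let i , eq = staircase-min u x v t<n (inj₂ 1+t<n) in suc i , eq

-- The other `n - 1` entries are each at least `l`. Applied to a maximal entry this yields `0<t`;
-- the dual below, applied to a minimal entry, yields `room`.
entry+lower≤sum : ∀ {v : Vector ℕ n} {l} → (∀ i → l ≤ v i) → ∀ i → v i + n * l ≤ sum v + l
entry+lower≤sum {suc n} {v} {l} l≤v zero = begin
  v zero + (l + n * l)        ≡⟨ cong (λ z → v zero + (l + z)) (sum-const n l) ⟨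
  v zero + (l + sum {n} (const l)) ≤⟨ +-monoʳ-≤ (v zero) (+-monoʳ-≤ l (sum-mono (l≤v ∘ suc))) ⟩
  v zero + (l + sum (tail v)) ≡⟨ cong (_+_ (v zero)) (+-comm l _) ⟩
  v zero + (sum (tail v) + l) ≡⟨ +-assoc (v zero) _ l ⟨
  sum v + l                   ∎
  where open ≤-Reasoning
entry+lower≤sum {suc n} {v} {l} l≤v (suc i) = begin
  v (suc i) + (l + n * l)     ≡⟨ eq (v (suc i)) l (n * l) ⟩
  l + (v (suc i) + n * l)     ≤⟨ +-mono-≤ (l≤v zero) (entry+lower≤sum (l≤v ∘ suc) i) ⟩
  v zero + (sum (tail v) + l) ≡⟨ +-assoc (v zero) _ l ⟨
  sum v + l                   ∎
  where
  open ≤-Reasoning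
  eq : ∀ x l y → x + (l + y) ≡ l + (x + y)
  eq = solve-∀

sum≤entry+upper : ∀ {v : Vector ℕ n} {u} → (∀ i → v i ≤ u) → ∀ i → sum v + u ≤ v i + n * u
sum≤entry+upper {suc n} {v} {u} v≤u zero = begin
  sum v + u                   ≡⟨ +-assoc (v zero) _ u ⟩
  v zero + (sum (tail v) + u) ≡⟨ cong (_+_ (v zero)) (+-comm _ u) ⟩
  v zero + (u + sum (tail v)) ≤⟨ +-monoʳ-≤ (v zero) (+-monoʳ-≤ u (sum-mono (v≤u ∘ suc))) ⟩
  v zero + (u + sum {n} (const u)) ≡⟨ cong (λ z → v zero + (u + z)) (sum-const n u) ⟩
  v zero + (u + n * u)        ∎
  where open ≤-Reasoning
sum≤entry+upper {suc n} {v} {u} v≤u (suc i) = begin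
  sum v + u                   ≡⟨ +-assoc (v zero) _ u ⟩
  v zero + (sum (tail v) + u) ≤⟨ +-mono-≤ (v≤u zero) (sum≤entry+upper (v≤u ∘ suc) i) ⟩
  u + (v (suc i) + n * u)     ≡⟨ eq u (v (suc i)) (n * u) ⟩
  v (suc i) + (u + n * u)     ∎
  where
  open ≤-Reasoning
  eq : ∀ u x y → u + (x + y) ≡ x + (u + y)
  eq = solve-∀

-- Division with remainder and the most spread sequence.

-- Starting from `M` entries `v`, the surplus of `S` raises `t` entries by `w` to `u`, and `ρ` is
-- left for one more entry. Stated without subtraction.
record Quotient (u v M S t : ℕ) : Set where
  field
    w ρ : ℕ
    u≡  : u ≡ v + w
    S≡  : S ≡ M * v + (t * w + ρ)
    ρ<w : ρ < w

quotient : ∀ u v M S (v<u : v < u) → M * v ≤ S → Quotient u v M S (quot u v M S v<u)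
quotient u v M S v<u Mv≤S = record
  { w   = u ∸ v
  ; ρ   = (S ∸ M * v) % (u ∸ v)
  ; u≡  = sym (m+[n∸m]≡n (<⇒≤ v<u))
  ; S≡  = trans (sym (m+[n∸m]≡n Mv≤S))
            (cong (_+_ (M * v)) (trans (m≡m%n+[m/n]*n (S ∸ M * v) (u ∸ v)) (+-comm _ (quot u v M S v<u * (u ∸ v)))))
  ; ρ<w = m%n<n (S ∸ M * v) (u ∸ v)
  }
  where
  instance
    u∸v≢0 : NonZero (u ∸ v)
    u∸v≢0 = >-nonZero (m<n⇒0<n∸m v<u)

module _ {u v M S t : ℕ} (Q : Quotient u v M S t) where
  open Quotient Q

  -- Identifies the integers `p` and `q` of the condition as division remainders, hence as
  -- nonnegative.
  rest≡ρ : rest u v M S t ≡ + ρ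
  rest≡ρ = trans (cong₂ (λ u S → S ℤ.- u ℤ.* + t ℤ.- + v ℤ.* (+ M ℤ.- + t)) u≡ℤ S≡ℤ) (eq (+ v) (+ w) (+ M) (+ t) (+ ρ))
    where
    u≡ℤ : + u ≡ + v ℤ.+ + w
    u≡ℤ = trans (cong +_ u≡) (ℤₚ.pos-+ v w)
    S≡ℤ : + S ≡ + M ℤ.* + v ℤ.+ (+ t ℤ.* + w ℤ.+ + ρ)
    S≡ℤ = trans (cong +_ S≡) (trans (ℤₚ.pos-+ (M * v) _)
      (cong₂ ℤ._+_ (ℤₚ.pos-* M v) (trans (ℤₚ.pos-+ (t * w) ρ) (cong (ℤ._+ + ρ) (ℤₚ.pos-* t w)))))
    eq : ∀ v w M t ρ → (M ℤ.* v ℤ.+ (t ℤ.* w ℤ.+ ρ)) ℤ.- (v ℤ.+ w) ℤ.* t ℤ.- v ℤ.* (M ℤ.- t) ≡ ρ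
    eq = ℤ-Solver.solve-∀

  instance
    w≢0 : NonZero w
    w≢0 = >-nonZero (≤-trans (s≤s z≤n) ρ<w)

  quotient≤ : S ≤ M * u → t ≤ M
  quotient≤ S≤Mu = *-cancelʳ-≤ t M w (≤-trans (m≤m+n _ ρ) (+-cancelˡ-≤ (M * v) _ _ (begin
    M * v + (t * w + ρ) ≡⟨ S≡ ⟨
    S                   ≤⟨ S≤Mu ⟩
    M * u               ≡⟨ cong (M *_) u≡ ⟩
    M * (v + w)         ≡⟨ *-distribˡ-+ M v w ⟩
    M * v + M * w       ∎)))
    where open ≤-Reasoning

  v+ρ≤u : v + ρ ≤ u
  v+ρ≤u = ≤-trans (+-monoʳ-≤ v (<⇒≤ ρ<w)) (≤-reflexive (sym u≡))

  v≤u : v ≤ u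
  v≤u = ≤-trans (m≤m+n v ρ) v+ρ≤u

  quotient-Staircase : S ≤ M * u → Staircase (+ S) (+ u) (+ v) (+ M) (+ t) (rest u v M S t)
  quotient-Staircase S≤Mu = record
    { ρ-def = refl
    ; 0≤t   = ℤ.+≤+ z≤n
    ; t≤M   = ℤ.+≤+ (quotient≤ S≤Mu)
    ; 0≤v   = ℤ.+≤+ z≤n
    ; 0≤ρ   = subst (ℤ.0ℤ ℤ.≤_) (sym rest≡ρ) (ℤ.+≤+ z≤n)
    ; v+ρ≤u = subst (λ z → + v ℤ.+ z ℤ.≤ + u) (sym rest≡ρ) (ℤ.+≤+ v+ρ≤u)
    }

  module _ {e : Vector ℕ M} (E : HasExtremes u v S e) where
    open HasExtremes E
    open ≤-Reasoning

    -- A maximal entry alone needs a surplus of `w`, more than the remainder `ρ` can supply.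
    0<t : 0 < t
    0<t = ≮⇒≥ λ t<1 → <⇒≱ ρ<w (+-cancelˡ-≤ (v + M * v) _ _ (begin
      v + M * v + w            ≡⟨ eq₁ v (M * v) w ⟩
      (v + w) + M * v          ≡⟨ cong (_+ M * v) u≡ ⟨
      u + M * v                ≡⟨ cong (_+ M * v) (proj₂ max-at) ⟨
      e (proj₁ max-at) + M * v ≤⟨ entry+lower≤sum min≤ (proj₁ max-at) ⟩
      sum e + v                ≡⟨ cong (_+ v) (trans total S≡) ⟩
      M * v + (t * w + ρ) + v  ≡⟨ cong (λ t → M * v + (t * w + ρ) + v) (n≤0⇒n≡0 (s≤s⁻¹ t<1)) ⟩
      M * v + ρ + v            ≡⟨ eq₂ v (M * v) ρ ⟩
      v + M * v + ρ            ∎))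
      where
      eq₁ : ∀ v μ w → v + μ + w ≡ (v + w) + μ
      eq₁ = solve-∀
      eq₂ : ∀ v μ ρ → μ + ρ + v ≡ v + μ + ρ
      eq₂ = solve-∀

    -- A minimal entry takes none of the surplus, so the surplus is at most `w` for each of the
    -- other `M - 1` entries.
    room : suc t * w + ρ ≤ M * w
    room = +-cancelˡ-≤ (v + M * v) _ _ (begin
      v + M * v + (suc t * w + ρ)       ≡⟨ eq₁ v w (M * v) (t * w) ρ ⟩
      M * v + (t * w + ρ) + (v + w)     ≡⟨ cong₂ _+_ (trans total S≡) u≡ ⟨
      sum e + u                         ≤⟨ sum≤entry+upper ≤max (proj₁ min-at) ⟩
      e (proj₁ min-at) + M * u          ≡⟨ cong₂ _+_ (proj₂ min-at) (trans (cong (M *_) u≡) (*-distribˡ-+ M v w)) ⟩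
      v + (M * v + M * w)               ≡⟨ +-assoc v _ _ ⟨
      v + M * v + M * w                 ∎)
      where
      eq₁ : ∀ v w μ τ ρ → v + μ + (w + τ + ρ) ≡ μ + (τ + ρ) + (v + w)
      eq₁ = solve-∀

    t<M : t < M
    t<M = *-cancelʳ-≤ (suc t) M w (≤-trans (m≤m+n _ ρ) room)

    -- If the intermediate entry is the last one, `room` forces `ρ` to be 0, and that entry is
    -- itself the minimum.
    ρ≡0∨1+t<M : v + ρ ≡ v ⊎ suc t < M
    ρ≡0∨1+t<M with m≤n⇒m<n∨m≡n t<M
    ... | inj₁ 1+t<M = inj₂ 1+t<M
    ... | inj₂ refl  = inj₁ (trans (cong (_+_ v) (n≤0⇒n≡0 ρ≤0)) (+-identityʳ v))
      where
      ρ≤0 : ρ ≤ 0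
      ρ≤0 = +-cancelˡ-≤ (suc t * w) _ _ (≤-trans room (≤-reflexive (sym (+-identityʳ _))))

    spread : Vector ℕ M
    spread = staircase u (v + ρ) v M t

    -- The given sequence `e` guarantees `0<t` and `t<M`, so that the staircase attains both
    -- extremes and has the right sum.
    spread-extremes : HasExtremes u v S spread
    spread-extremes = record
      { total  = +-cancelʳ-≡ (suc t * v) _ _ (begin-equality
          sum spread + suc t * v           ≡⟨ sum-staircase u (v + ρ) v t<M ⟩
          t * u + (v + ρ) + M * v          ≡⟨ cong (λ u → t * u + (v + ρ) + M * v) u≡ ⟩
          t * (v + w) + (v + ρ) + M * v    ≡⟨ eq t v w ρ M ⟩
          M * v + (t * w + ρ) + suc t * v  ≡⟨ cong (_+ suc t * v) S≡ ⟨
          S + suc t * v                    ∎)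
      ; max-at = staircase-max u (v + ρ) v t<M 0<t
      ; ≤max   = staircase-≤ M t v+ρ≤u v≤u
      ; min-at = staircase-min u (v + ρ) v t<M ρ≡0∨1+t<M
      ; min≤   = staircase-≥ M t (m≤m+n v ρ) v≤u
      }
      where
      eq : ∀ t v w ρ M → t * (v + w) + (v + ρ) + M * v ≡ M * v + (t * w + ρ) + (v + t * v)
      eq = solve-∀

-- Passage between integer and natural sequences.

sumℤ-+ : (e : Vector ℕ n) → sumℤ (λ i → + e i) ≡ + sum e
sumℤ-+ {zero}  e = refl
sumℤ-+ {suc n} e = trans (cong (ℤ._+_ (+ e zero)) (sumℤ-+ (tail e))) (sym (ℤₚ.pos-+ (e zero) _))

HasExtremesℤ : (u v S : ℕ) → Vector ℤ n → Set
HasExtremesℤ u v S e = sumℤ e ≡ + S × IsMaximum e (+ u) × IsMinimum e (+ v)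

toℤ : ∀ {u v S} {e : Vector ℕ n} → HasExtremes u v S e → HasExtremesℤ u v S (λ i → + e i)
toℤ {e = e} E =
    trans (sumℤ-+ e) (cong +_ total)
  , ((proj₁ max-at , cong +_ (proj₂ max-at)) , λ i → ℤ.+≤+ (≤max i))
  , ((proj₁ min-at , cong +_ (proj₂ min-at)) , λ i → ℤ.+≤+ (min≤ i))
  where open HasExtremes E

∣_∣ᵛ : Vector ℤ n → Vector ℕ n
∣ e ∣ᵛ i = ℤ.∣ e i ∣

module _ {u v S : ℕ} {e : Vector ℤ n} (E : HasExtremesℤ u v S e) where

  +∣e∣≡e : ∀ i → + ∣ e ∣ᵛ i ≡ e i
  +∣e∣≡e i = ℤₚ.0≤i⇒+∣i∣≡i (ℤₚ.≤-trans (ℤ.+≤+ z≤n) (proj₂ (proj₂ (proj₂ E)) i))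

  fromℤ : HasExtremes u v S ∣ e ∣ᵛ
  fromℤ =
    let Σ≡ , ((i , max) , ≤max) , ((j , min) , min≤) = E
    in record
      { total  = ℤₚ.+-injective (trans (sym (sumℤ-+ ∣ e ∣ᵛ)) (trans (sumℤ-cong +∣e∣≡e) Σ≡))
      ; max-at = i , cong ℤ.∣_∣ max
      ; ≤max   = λ i → ℤₚ.drop‿+≤+ (subst (ℤ._≤ + u) (sym (+∣e∣≡e i)) (≤max i))
      ; min-at = j , cong ℤ.∣_∣ min
      ; min≤   = λ i → ℤₚ.drop‿+≤+ (subst (+ v ℤ.≤_) (sym (+∣e∣≡e i)) (min≤ i))
      }

-- Cut inequalities and bipartite graphic pairs.

partialSum : ∀ {u v S} {e : Vector ℕ n} → HasExtremes u v S e → (K : Vector Bool n) →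
  PartialSum (+ S) (+ u) (+ v) (+ n) (+ card K) (+ sumOver K e)
partialSum {n} {u} {v} {_} {e} E K with refl ← HasExtremes.total E = record
  { 0≤k    = ℤ.+≤+ z≤n
  ; k≤M    = ℤ.+≤+ (card≤n K)
  ; x≤S    = ℤ.+≤+ (sumOver≤sum K e)
  ; x≤uk   = subst (+ sumOver K e ℤ.≤_) (ℤₚ.pos-* u (card K)) (ℤ.+≤+ (sumOver-upper K ≤max))
  ; x-tail = subst₂ ℤ._≤_ (pos-+-* (sumOver K e) v n) (pos-+-* (sum e) v (card K))
               (ℤ.+≤+ (sumOver-tail K min≤))
  }
  where
  open HasExtremes E
  pos-+-* : ∀ x y z → + (x + y * z) ≡ + x ℤ.+ + y ℤ.* + z
  pos-+-* x y z = trans (ℤₚ.pos-+ x (y * z)) (cong (ℤ._+_ (+ x)) (ℤₚ.pos-* y z))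

-- For each fixed `K`, the cuts over all `L` combine into the dominance condition of `galeRyser`.
cuts⇒graphic : ∀ {a b c d S} {e : Vector ℤ m} {f : Vector ℤ n} →
  HasExtremesℤ a b S e → HasExtremesℤ c d S f →
  (∀ K L → + sumOver K ∣ e ∣ᵛ ℤ.+ + sumOver L ∣ f ∣ᵛ ℤ.≤ + S ℤ.+ + card K ℤ.* + card L) →
  BipartiteGraphic (e , f)
cuts⇒graphic {S = S} {e = e} {f} E F cut =
  let A , rows , cols = galeRyser ∣ e ∣ᵛ ∣ f ∣ᵛ (trans E.total (sym F.total)) λ K →
        cuts⇒dominance ∣ f ∣ᵛ (card K) (sumOver K ∣ e ∣ᵛ) λ L →
        subst (λ σ → sumOver K ∣ e ∣ᵛ + sumOver L ∣ f ∣ᵛ ≤ σ + card K * card L) (sym F.total)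
          (ℤₚ.drop‿+≤+ (subst (λ π → + sumOver K ∣ e ∣ᵛ ℤ.+ + sumOver L ∣ f ∣ᵛ ℤ.≤ + S ℤ.+ π)
                               (sym (ℤₚ.pos-* (card K) (card L))) (cut K L)))
  in record { edge = A }
   , (λ i → trans (sym (+∣e∣≡e E i)) (cong +_ (trans (rows i) (sym (∣tabulate∣ (A i))))))
   , (λ j → trans (sym (+∣e∣≡e F j)) (cong +_ (trans (cols j) (sym (∣tabulate∣ (λ i → A i j))))))
  where
  module E = HasExtremes (fromℤ E)
  module F = HasExtremes (fromℤ F)

graphic⇒cuts : {e : Vector ℕ m} {f : Vector ℕ n} →
  BipartiteGraphic ((λ i → + e i) , (λ j → + f j)) →
  ∀ K L → sumOver K e + sumOver L f ≤ sum e + card K * card L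
graphic⇒cuts {e = e} {f} (G , rows , cols) K L = subst₂ _≤_
  (cong₂ _+_ (sum-cong-≗ λ i → cong (χ (K i) *_) (sym (e≡ i)))
             (sum-cong-≗ λ j → cong (χ (L j) *_) (sym (f≡ j))))
  (cong (_+ card K * card L) (sum-cong-≗ (sym ∘ e≡)))
  (edgeCount edge K L)
  where
  open BipartiteGraph G
  e≡ : ∀ i → e i ≡ card (edge i)
  e≡ i = trans (ℤₚ.+-injective (rows i)) (∣tabulate∣ (edge i))
  f≡ : ∀ j → f j ≡ card (λ i → edge i j)
  f≡ j = trans (ℤₚ.+-injective (cols j)) (∣tabulate∣ (λ i → edge i j))

-- Cutting the spread pair after `r` or `suc r` entries on one side and `s` or `suc s` on the other
-- gives exactly the four corner inequalities.
spread-corners : ∀ {a b c d m n S r s} (Q : Quotient a b m S r) (R : Quotient c d n S s)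
  {e : Vector ℕ m} {f : Vector ℕ n} (E : HasExtremes a b S e) (F : HasExtremes c d S f) →
  BipartiteGraphic ((λ i → + spread Q E i) , (λ j → + spread R F j)) →
  Corners (+ S) (+ a) (+ b) (+ r) (rest a b m S r) (+ c) (+ d) (+ s) (rest c d n S s)
spread-corners {a} {b} {c} {d} {m} {n} {S} {r} {s} Q R E F graphic =
  subst₂ (λ q p → Corners (+ S) (+ a) (+ b) (+ r) q (+ c) (+ d) (+ s) p)
    (sym (rest≡ρ Q)) (sym (rest≡ρ R)) (record
      { rs   = corner (t-card Q E) (t-sum Q E) (t-card R F) (t-sum R F)
      ; rs⁺  = corner (t-card Q E) (t-sum Q E) (1+t-card R F) (1+t-sum R F)
      ; r⁺s  = corner (1+t-card Q E) (1+t-sum Q E) (t-card R F) (t-sum R F)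
      ; r⁺s⁺ = corner (1+t-card Q E) (1+t-sum Q E) (1+t-card R F) (1+t-sum R F)
      })
  where
  corner : ∀ {k K X l L Y} → card {m} K ≡ k → + sumOver K (spread Q E) ≡ X →
    card {n} L ≡ l → + sumOver L (spread R F) ≡ Y → X ℤ.+ Y ℤ.≤ + S ℤ.+ + k ℤ.* + l
  corner {K = K} {L = L} refl refl refl refl =
    subst (λ π → + sumOver K (spread Q E) ℤ.+ + sumOver L (spread R F) ℤ.≤ + S ℤ.+ π) (ℤₚ.pos-* (card K) (card L))
      (ℤ.+≤+ (subst (λ σ → sumOver K (spread Q E) + sumOver L (spread R F) ≤ σ + card K * card L)
                (HasExtremes.total (spread-extremes Q E)) (graphic⇒cuts graphic K L)))

  module _ {u v M t} (Q : Quotient u v M S t) {e : Vector ℕ M} (E : HasExtremes u v S e) where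
    open Quotient Q using (ρ)

    +tu : + (t * u) ≡ + u ℤ.* + t
    +tu = trans (ℤₚ.pos-* t u) (ℤₚ.*-comm (+ t) (+ u))

    t-card : card (firsts M t) ≡ t
    t-card = card-firsts (<⇒≤ (t<M Q E))

    1+t-card : card (firsts M (suc t)) ≡ suc t
    1+t-card = card-firsts (t<M Q E)

    t-sum : + sumOver (firsts M t) (spread Q E) ≡ + u ℤ.* + t
    t-sum = trans (cong +_ (sumOver-firsts u (v + ρ) v (t<M Q E))) +tu

    1+t-sum : + sumOver (firsts M (suc t)) (spread Q E) ≡ + u ℤ.* + t ℤ.+ (+ v ℤ.+ + ρ)
    1+t-sum = trans (cong +_ (sumOver-firsts-suc u (v + ρ) v (t<M Q E)))
      (trans (ℤₚ.pos-+ (t * u) (v + ρ)) (cong₂ ℤ._+_ +tu (ℤₚ.pos-+ v ρ)))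

theorem1 : (a b c d m n S : ℕ) →
    n ≥ a → a ≥ b → m ≥ c → c ≥ d →
    (m * b) ⊔ (n * d) ≤ S → S ≤ (m * a) ⊓ (n * c) →
    -- Not explicit in the original, but needed: the bounds on S do not make P
    -- inhabited, and for (a,b,c,d,m,n,S) = (3,0,2,0,2,3,2) the set P is empty
    -- while the numerical inequality fails.
    Satisfiable (P a b c d m n S) →
    (P a b c d m n S ⊆ BipartiteGraphic) ⇔ ConditionB a b c d m n S
theorem1 a b c d m n S a≤n b≤a c≤m d≤c lower upper (_ , E₀ , F₀) = mk⇔ necessary sufficient
  where
  mb≤S : m * b ≤ S
  mb≤S = m⊔n≤o⇒m≤o (m * b) (n * d) lower
  nd≤S : n * d ≤ S
  nd≤S = m⊔n≤o⇒n≤o (m * b) (n * d) lower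

  necessary : P a b c d m n S ⊆ BipartiteGraphic → ConditionB a b c d m n S
  necessary all-graphic with a ≟ b | c ≟ d
  ... | yes a≡b | _       = inj₁ a≡b
  ... | no _    | yes c≡d = inj₂ (inj₁ c≡d)
  -- Only the spread pair is tested; the given members `E₀` and `F₀` ensure that it lies in `P`.
  ... | no a≢b  | no c≢d  = inj₂ (inj₂ (b<a , d<c , corners⇒minimum (+ S) (+ a) (+ b) _ _ (+ c) (+ d) _ _
      (spread-corners Q R (fromℤ E₀) (fromℤ F₀)
        (all-graphic (toℤ (spread-extremes Q (fromℤ E₀)) , toℤ (spread-extremes R (fromℤ F₀)))))))
    where
    b<a = ≤∧≢⇒< b≤a (≢-sym a≢b)
    d<c = ≤∧≢⇒< d≤c (≢-sym c≢d)
    Q = quotient a b m S b<a mb≤S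
    R = quotient c d n S d<c nd≤S

  *≤S : ∀ M v → M * v ≤ S → + v ℤ.* + M ℤ.≤ + S
  *≤S M v Mv≤S = subst (ℤ._≤ + S) (trans (ℤₚ.pos-* M v) (ℤₚ.*-comm (+ M) (+ v))) (ℤ.+≤+ Mv≤S)

  sufficient : ConditionB a b c d m n S → P a b c d m n S ⊆ BipartiteGraphic
  sufficient (inj₁ refl) (E , F) = cuts⇒graphic E F λ K L →
    constantBound (*≤S m b mb≤S) (ℤ.+≤+ c≤m) (partialSum (fromℤ E) K) (partialSum (fromℤ F) L)
  -- The constant side is now the second one, so the two sides exchange roles.
  sufficient (inj₂ (inj₁ refl)) (E , F) = cuts⇒graphic E F λ K L →
    subst₂ ℤ._≤_ (ℤₚ.+-comm (+ sumOver L _) (+ sumOver K _)) (cong (ℤ._+_ (+ S)) (ℤₚ.*-comm (+ card L) (+ card K)))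
      (constantBound (*≤S n d nd≤S) (ℤ.+≤+ a≤n) (partialSum (fromℤ F) L) (partialSum (fromℤ E) K))
  sufficient (inj₂ (inj₂ (b<a , d<c , condition))) (E , F) = cuts⇒graphic E F λ K L →
    cornerBound
      (quotient-Staircase (quotient a b m S b<a mb≤S) (m≤n⊓o⇒m≤n (m * a) (n * c) upper))
      (quotient-Staircase (quotient c d n S d<c nd≤S) (m≤n⊓o⇒m≤o (m * a) (n * c) upper))
      (ℤ.+≤+ a≤n) (ℤ.+≤+ c≤m)
      (minimum⇒corners (+ S) (+ a) (+ b) _ _ (+ c) (+ d) _ _ condition)
      (partialSum (fromℤ E) K) (partialSum (fromℤ F) L)
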